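{- Let $C_{(\geq,<)}(x,y)$ be the bivariate generating function of the Catalan words avoiding the ordered pair of relations $(\geq,<)$, where $x$ marks the length and $y$ marks the number of descents. Then $$C_{(\geq,<)}(x,y)=\frac {1-x+x^2-x^2y}{1-2x+x^2-x^2y}.$$
   Context: A Catalan word of length $n$ is a word $w=w_1w_2\cdots w_n$ over the non-negative integers with $w_1=0$ and $0\leq w_i\leq w_{i-1}+1$ for $i=2,\dots,n$; the empty word is the unique Catalan word of length $0$. For relations $X,Y\in\{<,>,\leq,\geq,=,\neq\}$, a word $w$ contains the pattern $(X,Y)$ if there is an index $i\geq 1$ (with $i+2\le n$) such that $w_i\,X\,w_{i+1}$ and $w_{i+1}\,Y\,w_{i+2}$; otherwise $w$ avoids $(X,Y)$. The number of descents $\mathrm{des}(w)$ is the number of indices $i$ with $w_i>w_{i+1}$. The bivariate generating function is $C_{(X,Y)}(x,y)=\sum_{w}x^{|w|}y^{\mathrm{des}(w)}$, the sum being over all Catalan words $w$ (of any length $|w|\geq 0$) avoiding $(X,Y)$. Identities are between formal power series in $x$ with coefficients polynomials in $y$. -}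

module Defs where

open import Data.Bool using (if_then_else_)
open import Data.Empty using (⊥)
open import Data.Integer as ℤ using (ℤ; 0ℤ; 1ℤ)
open import Data.List using (List; []; _∷_; _++_; map; concatMap; filter; foldr; length; replicate; upTo)
open import Data.List.Membership.Propositional using (_∈_; find; lose)
open import Data.List.Membership.Propositional.Properties
  using (∈-map⁺; ∈-map⁻; ∈-concatMap⁺; ∈-concatMap⁻; ∈-upTo⁺; ∈-upTo⁻)
open import Data.List.Properties using (∷-injectiveˡ; ∷-injectiveʳ)
open import Data.List.Relation.Unary.All as All using (All)
import Data.List.Relation.Unary.All.Properties as All
import Data.List.Relation.Unary.AllPairs as AllPairs
import Data.List.Relation.Unary.AllPairs.Properties as AllPairs
open import Data.List.Relation.Unary.Any using (here)
open import Data.List.Relation.Unary.Linked as Linked using (Linked; [-])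
open import Data.List.Relation.Unary.Unique.Propositional using (Unique)
import Data.List.Relation.Unary.Unique.Propositional.Properties as Unique
open import Data.Nat using (ℕ; zero; suc; _∸_; _≤_; s≤s; s≤s⁻¹; _>?_)
open import Data.Product using (Σ-syntax; _×_; _,_; proj₁)
open import Data.Sum using (_⊎_; inj₁; inj₂)
open import Level using (0ℓ)
open import Relation.Binary using (Rel; Decidable)
open import Relation.Binary.PropositionalEquality using (_≡_; refl; cong; trans; sym)
open import Relation.Nullary using (¬_; Dec; yes; no; does; ¬?; map′; _×-dec_; _⊎-dec_)
open import Algebra.Definitions using (Invertible)

Word : Set
Word = List ℕ

Step : Rel ℕ 0ℓ
Step a b = b ≤ suc a

data IsCatalan : Word → Set where
  empty    : IsCatalan []
  nonempty : ∀ {w} → Linked Step (0 ∷ w) → IsCatalan (0 ∷ w)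

data Contains (X Y : Rel ℕ 0ℓ) : Word → Set where
  here  : ∀ {a b c w} → X a b → Y b c → Contains X Y (a ∷ b ∷ c ∷ w)
  there : ∀ {a w} → Contains X Y w → Contains X Y (a ∷ w)

Avoids : (X Y : Rel ℕ 0ℓ) → Word → Set
Avoids X Y w = ¬ Contains X Y w

des : Word → ℕ
des []          = 0
des (a ∷ [])    = 0
des (a ∷ b ∷ w) = if does (a >? b) then suc (des (b ∷ w)) else des (b ∷ w)

module _ {X Y : Rel ℕ 0ℓ} (X? : Decidable X) (Y? : Decidable Y) where

  contains? : ∀ w → Dec (Contains X Y w)
  contains? []           = no λ ()
  contains? (a ∷ [])     = no λ { (there ()) }
  contains? (a ∷ b ∷ []) = no λ { (there (there ())) }
  contains? (a ∷ w@(b ∷ c ∷ _)) =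
    map′ (λ { (inj₁ (p , q)) → here p q ; (inj₂ r) → there r })
         (λ { (here p q) → inj₁ (p , q) ; (there r) → inj₂ r })
         ((X? a b ×-dec Y? b c) ⊎-dec contains? w)

  avoids? : ∀ w → Dec (Avoids X Y w)
  avoids? w = ¬? (contains? w)

-- continuations a n lists the words v of length n that may follow a letter a
-- in a Catalan word.
continuations : ℕ → ℕ → List Word
continuations a zero    = [] ∷ []
continuations a (suc n) =
  concatMap (λ b → map (b ∷_) (continuations b n)) (upTo (suc (suc a)))

catalanWords : ℕ → List Word
catalanWords zero    = [] ∷ []
catalanWords (suc n) = map (0 ∷_) (continuations 0 n)

-- catalanWords n lists every Catalan word of length n exactly once: this is
-- the content of catalanWords-sound, catalanWords-complete and
-- catalanWords-unique.

continuations-sound : ∀ a n {v} → v ∈ continuations a n →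
                      Linked Step (a ∷ v) × length v ≡ n
continuations-sound a zero (here refl) = [-] , refl
continuations-sound a (suc n) v∈
  with b , b∈ , v∈b ← find (∈-concatMap⁻ (λ b → map (b ∷_) (continuations b n)) {xs = upTo (suc (suc a))} v∈)
  with u , u∈ , refl ← ∈-map⁻ (b ∷_) v∈b
  with l , e ← continuations-sound b n u∈
  = (s≤s⁻¹ (∈-upTo⁻ b∈) Linked.∷ l) , cong suc e

continuations-complete : ∀ a {v} → Linked Step (a ∷ v) →
                         v ∈ continuations a (length v)
continuations-complete a [-] = here refl
continuations-complete a {b ∷ v} (s Linked.∷ l) =
  ∈-concatMap⁺ (λ b → map (b ∷_) (continuations b (length v)))
    (lose (∈-upTo⁺ (s≤s s)) (∈-map⁺ (b ∷_) (continuations-complete b l)))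

continuations-unique : ∀ a n → Unique (continuations a n)
continuations-unique a zero    = All.[] AllPairs.∷ AllPairs.[]
continuations-unique a (suc n) = Unique.concat⁺
  (All.map⁺ (All.tabulate λ {b} _ →
    Unique.map⁺ ∷-injectiveʳ (continuations-unique b n)))
  (AllPairs.map⁺ (AllPairs.map disjoint (Unique.upTo⁺ (suc (suc a)))))
  where
  disjoint : ∀ {b c} → ¬ b ≡ c → ∀ {v} →
             v ∈ map (b ∷_) (continuations b n) ×
             v ∈ map (c ∷_) (continuations c n) → ⊥
  disjoint {b} {c} b≢c (p , q)
    with _ , _ , e ← ∈-map⁻ (b ∷_) p | _ , _ , e′ ← ∈-map⁻ (c ∷_) q
    = b≢c (∷-injectiveˡ (trans (sym e) e′))

catalanWords-sound : ∀ n {w} → w ∈ catalanWords n → IsCatalan w × length w ≡ n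
catalanWords-sound zero (here refl) = empty , refl
catalanWords-sound (suc n) w∈
  with v , v∈ , refl ← ∈-map⁻ (0 ∷_) w∈
  with l , e ← continuations-sound 0 n v∈
  = nonempty l , cong suc e

catalanWords-complete : ∀ {w} → IsCatalan w → w ∈ catalanWords (length w)
catalanWords-complete empty        = here refl
catalanWords-complete (nonempty l) = ∈-map⁺ (0 ∷_) (continuations-complete 0 l)

catalanWords-unique : ∀ n → Unique (catalanWords n)
catalanWords-unique zero    = All.[] AllPairs.∷ AllPairs.[]
catalanWords-unique (suc n) = Unique.map⁺ ∷-injectiveʳ (continuations-unique 0 n)

-- Polynomials in y: coefficient lists, constant term first; trailing zeros are allowed, so
-- equality is equality of all coefficients.
Poly : Set
Poly = List ℤ

coeff : Poly → ℕ → ℤ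
coeff []      _       = 0ℤ
coeff (a ∷ p) zero    = a
coeff (a ∷ p) (suc k) = coeff p k

infix 4 _≈ᵖ_
_≈ᵖ_ : Rel Poly 0ℓ
p ≈ᵖ q = ∀ k → coeff p k ≡ coeff q k

infixl 6 _+ᵖ_
_+ᵖ_ : Poly → Poly → Poly
[]      +ᵖ q       = q
(a ∷ p) +ᵖ []      = a ∷ p
(a ∷ p) +ᵖ (b ∷ q) = (a ℤ.+ b) ∷ (p +ᵖ q)

-ᵖ_ : Poly → Poly
-ᵖ_ = map (ℤ.-_)

infixl 7 _*ᵖ_
_*ᵖ_ : Poly → Poly → Poly
[]      *ᵖ q = []
(a ∷ p) *ᵖ q = map (a ℤ.*_) q +ᵖ (0ℤ ∷ (p *ᵖ q))

y^_ : ℕ → Poly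
y^ k = replicate k 0ℤ ++ (1ℤ ∷ [])

sumᵖ : List Poly → Poly
sumᵖ = foldr _+ᵖ_ []

-- Formal power series in x over ℤ[y]: F n is the coefficient of xⁿ.
Series : Set
Series = ℕ → Poly

infix 4 _≈_
_≈_ : Rel Series 0ℓ
F ≈ G = ∀ n → F n ≈ᵖ G n

const : Poly → Series
const p zero    = p
const p (suc n) = []

1# 2# x y : Series
1# = const (1ℤ ∷ [])
2# = const (ℤ.+ 2 ∷ [])
y  = const (y^ 1)
x 1 = 1ℤ ∷ []
x _ = []

infixl 6 _+_ _-_
infixl 7 _*_
infixr 8 _^_

_+_ _-_ _*_ : Series → Series → Series
(F + G) n = F n +ᵖ G n
(F - G) n = F n +ᵖ (-ᵖ G n)
(F * G) n = sumᵖ (map (λ i → F i *ᵖ G (n ∸ i)) (upTo (suc n)))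

_^_ : Series → ℕ → Series
F ^ zero  = 1#
F ^ suc n = F * F ^ n

-- F ≈ N / D: the series D has a multiplicative inverse D⁻¹, and F = N D⁻¹.
infix 4 _≈_/_
_≈_/_ : Series → Series → Series → Set
F ≈ N / D = Σ[ D-inv ∈ Invertible _≈_ 1# _*_ D ] F ≈ N * proj₁ D-inv

C : {X Y : Rel ℕ 0ℓ} → Decidable X → Decidable Y → Series
C X? Y? n = sumᵖ (map (λ w → y^ des w) (filter (avoids? X? Y?) (catalanWords n)))

{-# OPTIONS --safe #-}

-- Once a word avoiding (≥, <) has taken a weak descent it stays weakly
-- decreasing. Let A n a and B n a be the descent polynomials of the avoiding
-- words a v and a a v, where v runs over the continuations of a of length n;
-- the words counted by B are exactly the weakly decreasing ones. Splitting off
-- the first letter of v gives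
--   A (n+1) a = B (n+1) a + A n (a+1),   B (n+1) a = B n a + y Σ_{b<a} B n b.
-- The second equation is a first-order difference equation in a, the first one
-- transports it from B to A, and at a = 0, where B n 0 does not depend on n, it
-- becomes the recurrence
--   U (n+2) = 2 U (n+1) − (1 − y) U n   for   U n = A n 0 = [xⁿ⁺¹] C.
-- So U is the inverse of the denominator, and since the numerator is the
-- denominator plus x, the quotient is 1 + x U = C.
module Submission where

open import Defs
open import Data.Nat using (_≥?_; _<?_)

open import Algebra.Bundles using (CommutativeMonoid)
open import Algebra.Core using (Op₂)
import Algebra.Construct.Pointwise as Pointwise
open import Algebra.Definitions using (Congruent₂; Commutative; LeftZero)
import Algebra.Morphism.MonoidMonomorphism as MonoidMonomorphism
open import Data.Bool using (true; false; if_then_else_)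
open import Data.Integer as ℤ using (ℤ; 0ℤ; 1ℤ; -1ℤ)
import Data.Integer.Properties as ℤ
open import Data.Integer.Tactic.RingSolver using (solve-∀)
open import Data.List using (List; []; _∷_; [_]; _++_; applyUpTo; map; concatMap; filter; foldr; upTo)
open import Data.List.Properties using (map-applyUpTo; upTo-∷ʳ)
open import Data.List.Relation.Unary.All as All using (All; []; _∷_)
open import Data.List.Relation.Unary.All.Properties using (all-upTo)
open import Data.Nat as ℕ using (ℕ; zero; suc; _∸_; _≤_; _<_; _≥_; _>?_)
import Data.Nat.Properties as ℕ
open import Data.Product using (_,_)
open import Function using (module Equivalence; _∘_; id; _⇔_; mk⇔)
open import Level using (0ℓ)
open import Relation.Binary.PropositionalEquality
  using (_≡_; refl; sym; trans; cong; cong₂; module ≡-Reasoning)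
open import Relation.Nullary using (does; contradiction)
open import Relation.Nullary.Decidable using (dec-true; dec-false; does-⇔)
open import Relation.Unary using (Pred; Decidable)

-- Cauchy products over a commutative monoid.

module Convolution {c ℓ} (M : CommutativeMonoid c ℓ)
  (_·_ : Op₂ (CommutativeMonoid.Carrier M))
  (·-cong : Congruent₂ (CommutativeMonoid._≈_ M) _·_)
  (·-comm : Commutative (CommutativeMonoid._≈_ M) _·_)
  (·-zeroˡ : LeftZero (CommutativeMonoid._≈_ M) (CommutativeMonoid.ε M) _·_)
  where

  private module M = CommutativeMonoid M
  open M using (ε; _∙_; ∙-cong; ∙-congˡ) renaming (Carrier to A; _≈_ to _≋_)
  open import Relation.Binary.Reasoning.Setoid M.setoid

  -- Used at two levels: over ℤ it describes `_*ᵖ_`, and over polynomials in y it describes `_*_`.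
  -- Commutativity and congruence are thus proved once for both products.
  conv : (ℕ → A) → (ℕ → A) → ℕ → A
  conv f g zero    = f 0 · g 0
  conv f g (suc n) = (f 0 · g (suc n)) ∙ conv (f ∘ suc) g n

  -- The definition splits off the first term of the Cauchy sum; splitting off the last one is what
  -- `conv-comm` needs, since swapping the factors reverses the sum.
  conv-suc : ∀ f g n → conv f g (suc n) ≋ conv f (g ∘ suc) n ∙ (f (suc n) · g 0)
  conv-suc f g zero    = M.refl
  conv-suc f g (suc n) = begin
    (f 0 · g (suc (suc n))) ∙ conv (f ∘ suc) g (suc n)
      ≈⟨ ∙-congˡ (conv-suc (f ∘ suc) g n) ⟩
    (f 0 · g (suc (suc n))) ∙ (conv (f ∘ suc) (g ∘ suc) n ∙ (f (suc (suc n)) · g 0))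
      ≈⟨ M.assoc _ _ _ ⟨
    conv f (g ∘ suc) (suc n) ∙ (f (suc (suc n)) · g 0) ∎

  conv-comm : ∀ f g n → conv f g n ≋ conv g f n
  conv-comm f g zero    = ·-comm (f 0) (g 0)
  conv-comm f g (suc n) = begin
    (f 0 · g (suc n)) ∙ conv (f ∘ suc) g n  ≈⟨ ∙-cong (·-comm _ _) (conv-comm (f ∘ suc) g n) ⟩
    (g (suc n) · f 0) ∙ conv g (f ∘ suc) n  ≈⟨ M.comm _ _ ⟩
    conv g (f ∘ suc) n ∙ (g (suc n) · f 0)  ≈⟨ conv-suc g f n ⟨
    conv g f (suc n)                        ∎

  conv-congˡ : ∀ f f′ g → (∀ n → f n ≋ f′ n) → ∀ n → conv f g n ≋ conv f′ g n
  conv-congˡ f f′ g f≋f′ zero    = ·-cong (f≋f′ 0) M.refl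
  conv-congˡ f f′ g f≋f′ (suc n) =
    ∙-cong (·-cong (f≋f′ 0) M.refl) (conv-congˡ (f ∘ suc) (f′ ∘ suc) g (f≋f′ ∘ suc) n)

  conv-zeroˡ : ∀ f g → (∀ n → f n ≋ ε) → ∀ n → conv f g n ≋ ε
  conv-zeroˡ f g f≋ε zero    = M.trans (·-cong (f≋ε 0) M.refl) (·-zeroˡ _)
  conv-zeroˡ f g f≋ε (suc n) = M.trans
    (∙-cong (M.trans (·-cong (f≋ε 0) M.refl) (·-zeroˡ _)) (conv-zeroˡ (f ∘ suc) g (f≋ε ∘ suc) n))
    (M.identityˡ ε)

  conv-constˡ : ∀ f g → (∀ n → f (suc n) ≋ ε) → ∀ n → conv f g n ≋ f 0 · g n
  conv-constˡ f g f≋ε zero    = M.refl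
  conv-constˡ f g f≋ε (suc n) = M.trans (∙-congˡ (conv-zeroˡ (f ∘ suc) g f≋ε n)) (M.identityʳ _)

-- Polynomials in y through their coefficients.

private module ℤConv = Convolution ℤ.+-0-commutativeMonoid ℤ._*_ (cong₂ ℤ._*_) ℤ.*-comm ℤ.*-zeroˡ

convℤ : (ℕ → ℤ) → (ℕ → ℤ) → ℕ → ℤ
convℤ = ℤConv.conv

coeff-+ : ∀ p q k → coeff (p +ᵖ q) k ≡ coeff p k ℤ.+ coeff q k
coeff-+ []      q       k       = sym (ℤ.+-identityˡ _)
coeff-+ (a ∷ p) []      k       = sym (ℤ.+-identityʳ _)
coeff-+ (a ∷ p) (b ∷ q) zero    = refl
coeff-+ (a ∷ p) (b ∷ q) (suc k) = coeff-+ p q k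

coeff-neg : ∀ p k → coeff (-ᵖ p) k ≡ ℤ.- coeff p k
coeff-neg []      k       = refl
coeff-neg (a ∷ p) zero    = refl
coeff-neg (a ∷ p) (suc k) = coeff-neg p k

coeff-scale : ∀ a p k → coeff (map (a ℤ.*_) p) k ≡ a ℤ.* coeff p k
coeff-scale a []      k       = sym (ℤ.*-zeroʳ a)
coeff-scale a (b ∷ p) zero    = refl
coeff-scale a (b ∷ p) (suc k) = coeff-scale a p k

coeff-* : ∀ p q k → coeff (p *ᵖ q) k ≡ convℤ (coeff p) (coeff q) k
coeff-* [] q k = sym (ℤConv.conv-zeroˡ (coeff []) (coeff q) (λ _ → refl) k)
coeff-* (a ∷ p) q k = trans (coeff-+ (map (a ℤ.*_) q) (0ℤ ∷ (p *ᵖ q)) k) (go k)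
  where
  go : ∀ k →
    coeff (map (a ℤ.*_) q) k ℤ.+ coeff (0ℤ ∷ (p *ᵖ q)) k ≡ convℤ (coeff (a ∷ p)) (coeff q) k
  go zero    = trans (ℤ.+-identityʳ _) (coeff-scale a q 0)
  go (suc k) = cong₂ ℤ._+_ (coeff-scale a q (suc k)) (coeff-* p q k)

-- The laws are pulled back along `coeff` from pointwise addition of integer sequences; `coeff`
-- reflects equality by the very definition of `_≈ᵖ_`, so trailing zeros cause no trouble.
+ᵖ-commutativeMonoid : CommutativeMonoid 0ℓ 0ℓ
+ᵖ-commutativeMonoid = record
  { isCommutativeMonoid = MonoidMonomorphism.isCommutativeMonoid
      {M₁ = record { _≈_ = _≈ᵖ_ ; _∙_ = _+ᵖ_ ; ε = [] }} {⟦_⟧ = coeff}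
      (record
        { isMonoidHomomorphism = record
          { isMagmaHomomorphism = record
            { isRelHomomorphism = record { cong = id }
            ; homo              = coeff-+
            }
          ; ε-homo = λ _ → refl
          }
        ; injective = id
        })
      (CommutativeMonoid.isCommutativeMonoid (Pointwise.commutativeMonoid ℕ ℤ.+-0-commutativeMonoid))
  }

private module ᵖ = CommutativeMonoid +ᵖ-commutativeMonoid

*ᵖ-comm : ∀ p q → p *ᵖ q ≈ᵖ q *ᵖ p
*ᵖ-comm p q k = begin
  coeff (p *ᵖ q) k              ≡⟨ coeff-* p q k ⟩
  convℤ (coeff p) (coeff q) k   ≡⟨ ℤConv.conv-comm (coeff p) (coeff q) k ⟩
  convℤ (coeff q) (coeff p) k   ≡⟨ coeff-* q p k ⟨
  coeff (q *ᵖ p) k              ∎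
  where open ≡-Reasoning

*ᵖ-congˡ : ∀ p p′ q → p ≈ᵖ p′ → p *ᵖ q ≈ᵖ p′ *ᵖ q
*ᵖ-congˡ p p′ q p≈p′ k = begin
  coeff (p *ᵖ q) k              ≡⟨ coeff-* p q k ⟩
  convℤ (coeff p) (coeff q) k   ≡⟨ ℤConv.conv-congˡ (coeff p) (coeff p′) (coeff q) p≈p′ k ⟩
  convℤ (coeff p′) (coeff q) k  ≡⟨ coeff-* p′ q k ⟨
  coeff (p′ *ᵖ q) k             ∎
  where open ≡-Reasoning

*ᵖ-cong : ∀ p p′ q q′ → p ≈ᵖ p′ → q ≈ᵖ q′ → p *ᵖ q ≈ᵖ p′ *ᵖ q′
*ᵖ-cong p p′ q q′ p≈p′ q≈q′ k = begin
  coeff (p *ᵖ q) k    ≡⟨ *ᵖ-congˡ p p′ q p≈p′ k ⟩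
  coeff (p′ *ᵖ q) k   ≡⟨ *ᵖ-comm p′ q k ⟩
  coeff (q *ᵖ p′) k   ≡⟨ *ᵖ-congˡ q q′ p′ q≈q′ k ⟩
  coeff (q′ *ᵖ p′) k  ≡⟨ *ᵖ-comm q′ p′ k ⟩
  coeff (p′ *ᵖ q′) k  ∎
  where open ≡-Reasoning

coeff-const-* : ∀ a p k → coeff ([ a ] *ᵖ p) k ≡ a ℤ.* coeff p k
coeff-const-* a p k = trans (coeff-* [ a ] p k)
  (ℤConv.conv-constˡ (coeff [ a ]) (coeff p) (λ _ → refl) k)

-- Multiplication by y on coefficient sequences.
shift : (ℕ → ℤ) → ℕ → ℤ
shift f zero    = 0ℤ
shift f (suc k) = f k

shift-cong : ∀ {f g} → (∀ k → f k ≡ g k) → ∀ k → shift f k ≡ shift g k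
shift-cong f≡g zero    = refl
shift-cong f≡g (suc k) = f≡g k

shift-+ : ∀ f g k → shift (λ j → f j ℤ.+ g j) k ≡ shift f k ℤ.+ shift g k
shift-+ f g zero    = refl
shift-+ f g (suc k) = refl

coeff-1-y-* : ∀ p k → coeff ((1ℤ ∷ -1ℤ ∷ []) *ᵖ p) k ≡ coeff p k ℤ.- shift (coeff p) k
coeff-1-y-* p k = trans (coeff-* (1ℤ ∷ -1ℤ ∷ []) p k) (go k)
  where
  open ≡-Reasoning
  go : ∀ k → convℤ (coeff (1ℤ ∷ -1ℤ ∷ [])) (coeff p) k ≡ coeff p k ℤ.- shift (coeff p) k
  go zero    = trans (ℤ.*-identityˡ _) (sym (ℤ.+-identityʳ _))
  go (suc k) = begin
    1ℤ ℤ.* coeff p (suc k) ℤ.+ convℤ (coeff [ -1ℤ ]) (coeff p) k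
      ≡⟨ cong₂ ℤ._+_ (ℤ.*-identityˡ (coeff p (suc k)))
           (ℤConv.conv-constˡ (coeff [ -1ℤ ]) (coeff p) (λ _ → refl) k) ⟩
    coeff p (suc k) ℤ.+ -1ℤ ℤ.* coeff p k
      ≡⟨ cong (λ c → coeff p (suc k) ℤ.+ c) (ℤ.-1*i≡-i _) ⟩
    coeff p (suc k) ℤ.- coeff p k ∎

-- Products of power series in x.

private module SeriesConv = Convolution +ᵖ-commutativeMonoid _*ᵖ_ (λ {p} {p′} {q} {q′} → *ᵖ-cong p p′ q q′) *ᵖ-comm (λ _ _ → refl)

convᵖ : Series → Series → Series
convᵖ = SeriesConv.conv

*-suc : ∀ F G n → (F * G) (suc n) ≡ F 0 *ᵖ G (suc n) +ᵖ ((F ∘ suc) * G) n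
*-suc F G n = cong (λ ps → F 0 *ᵖ G (suc n) +ᵖ sumᵖ ps) (begin
  map (λ i → F i *ᵖ G (suc n ∸ i)) (applyUpTo suc (suc n))
    ≡⟨ map-applyUpTo suc (λ i → F i *ᵖ G (suc n ∸ i)) (suc n) ⟩
  applyUpTo (λ i → F (suc i) *ᵖ G (n ∸ i)) (suc n)
    ≡⟨ map-applyUpTo id (λ i → F (suc i) *ᵖ G (n ∸ i)) (suc n) ⟨
  map (λ i → F (suc i) *ᵖ G (n ∸ i)) (upTo (suc n)) ∎)
  where open ≡-Reasoning

*≈conv : ∀ F G → F * G ≈ convᵖ F G
*≈conv F G zero    = ᵖ.identityʳ (F 0 *ᵖ G 0)
*≈conv F G (suc n) k = begin
  coeff ((F * G) (suc n)) k
    ≡⟨ cong (λ p → coeff p k) (*-suc F G n) ⟩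
  coeff (F 0 *ᵖ G (suc n) +ᵖ ((F ∘ suc) * G) n) k
    ≡⟨ ᵖ.∙-congˡ {F 0 *ᵖ G (suc n)} {((F ∘ suc) * G) n} {convᵖ (F ∘ suc) G n}
         (*≈conv (F ∘ suc) G n) k ⟩
  coeff (convᵖ F G (suc n)) k ∎
  where open ≡-Reasoning

*-comm : ∀ F G → F * G ≈ G * F
*-comm F G n k = begin
  coeff ((F * G) n) k    ≡⟨ *≈conv F G n k ⟩
  coeff (convᵖ F G n) k  ≡⟨ SeriesConv.conv-comm F G n k ⟩
  coeff (convᵖ G F n) k  ≡⟨ *≈conv G F n k ⟨
  coeff ((G * F) n) k    ∎
  where open ≡-Reasoning

*-congˡ : ∀ F F′ G → F ≈ F′ → F * G ≈ F′ * G
*-congˡ F F′ G F≈F′ n k = begin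
  coeff ((F * G) n) k     ≡⟨ *≈conv F G n k ⟩
  coeff (convᵖ F G n) k   ≡⟨ SeriesConv.conv-congˡ F F′ G F≈F′ n k ⟩
  coeff (convᵖ F′ G n) k  ≡⟨ *≈conv F′ G n k ⟨
  coeff ((F′ * G) n) k    ∎
  where open ≡-Reasoning

*-constˡ : ∀ F G → (∀ n → F (suc n) ≈ᵖ []) → ∀ n → (F * G) n ≈ᵖ F 0 *ᵖ G n
*-constˡ F G F≈0 n k = trans (*≈conv F G n k) (SeriesConv.conv-constˡ F G F≈0 n k)

x*-suc : ∀ G n → (x * G) (suc n) ≈ᵖ G n
x*-suc G n k = begin
  coeff ((x * G) (suc n)) k    ≡⟨ cong (λ p → coeff p k) (*-suc x G n) ⟩
  coeff (((x ∘ suc) * G) n) k  ≡⟨ *-constˡ (x ∘ suc) G (λ _ _ → refl) n k ⟩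
  coeff ([ 1ℤ ] *ᵖ G n) k      ≡⟨ coeff-const-* 1ℤ (G n) k ⟩
  1ℤ ℤ.* coeff (G n) k         ≡⟨ ℤ.*-identityˡ _ ⟩
  coeff (G n) k                ∎
  where open ≡-Reasoning

-- 1 + b x + (1 − y) x²
quadratic : ℤ → Series
quadratic b 0 = [ 1ℤ ]
quadratic b 1 = [ b ]
quadratic b 2 = 1ℤ ∷ -1ℤ ∷ []
quadratic b _ = []

quadratic-*₀ : ∀ b G k → coeff ((quadratic b * G) 0) k ≡ coeff (G 0) k
quadratic-*₀ b G k = begin
  coeff ((quadratic b * G) 0) k  ≡⟨ *≈conv (quadratic b) G 0 k ⟩
  coeff ([ 1ℤ ] *ᵖ G 0) k        ≡⟨ coeff-const-* 1ℤ (G 0) k ⟩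
  1ℤ ℤ.* coeff (G 0) k           ≡⟨ ℤ.*-identityˡ _ ⟩
  coeff (G 0) k                  ∎
  where open ≡-Reasoning

quadratic-*₁ : ∀ b G k → coeff ((quadratic b * G) 1) k ≡ coeff (G 1) k ℤ.+ b ℤ.* coeff (G 0) k
quadratic-*₁ b G k = begin
  coeff ((quadratic b * G) 1) k
    ≡⟨ *≈conv (quadratic b) G 1 k ⟩
  coeff ([ 1ℤ ] *ᵖ G 1 +ᵖ [ b ] *ᵖ G 0) k
    ≡⟨ coeff-+ ([ 1ℤ ] *ᵖ G 1) _ k ⟩
  coeff ([ 1ℤ ] *ᵖ G 1) k ℤ.+ coeff ([ b ] *ᵖ G 0) k
    ≡⟨ cong₂ ℤ._+_ (trans (coeff-const-* 1ℤ (G 1) k) (ℤ.*-identityˡ (coeff (G 1) k)))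
         (coeff-const-* b (G 0) k) ⟩
  coeff (G 1) k ℤ.+ b ℤ.* coeff (G 0) k ∎
  where open ≡-Reasoning

quadratic-*₂ : ∀ b G n k → coeff ((quadratic b * G) (2 ℕ.+ n)) k ≡
  coeff (G (2 ℕ.+ n)) k ℤ.+ (b ℤ.* coeff (G (1 ℕ.+ n)) k ℤ.+ (coeff (G n) k ℤ.- shift (coeff (G n)) k))
quadratic-*₂ b G n k = begin
  coeff ((Q * G) (2 ℕ.+ n)) k
    ≡⟨ cong (λ p → coeff p k) (*-suc Q G (suc n)) ⟩
  coeff ([ 1ℤ ] *ᵖ G (2 ℕ.+ n) +ᵖ ((Q ∘ suc) * G) (suc n)) k
    ≡⟨ coeff-+ ([ 1ℤ ] *ᵖ G (2 ℕ.+ n)) _ k ⟩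
  coeff ([ 1ℤ ] *ᵖ G (2 ℕ.+ n)) k ℤ.+ coeff (((Q ∘ suc) * G) (suc n)) k
    ≡⟨ cong₂ ℤ._+_ (trans (coeff-const-* 1ℤ (G (2 ℕ.+ n)) k) (ℤ.*-identityˡ _))
         (cong (λ p → coeff p k) (*-suc (Q ∘ suc) G n)) ⟩
  coeff (G (2 ℕ.+ n)) k ℤ.+ coeff ([ b ] *ᵖ G (1 ℕ.+ n) +ᵖ ((Q ∘ suc ∘ suc) * G) n) k
    ≡⟨ cong (λ c → coeff (G (2 ℕ.+ n)) k ℤ.+ c) (coeff-+ ([ b ] *ᵖ G (1 ℕ.+ n)) _ k) ⟩
  coeff (G (2 ℕ.+ n)) k ℤ.+ (coeff ([ b ] *ᵖ G (1 ℕ.+ n)) k ℤ.+ coeff (((Q ∘ suc ∘ suc) * G) n) k)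
    ≡⟨ cong (λ c → coeff (G (2 ℕ.+ n)) k ℤ.+ c)
         (cong₂ ℤ._+_ (coeff-const-* b (G (1 ℕ.+ n)) k)
           (trans (*-constˡ (Q ∘ suc ∘ suc) G (λ _ _ → refl) n k) (coeff-1-y-* (G n) k))) ⟩
  coeff (G (2 ℕ.+ n)) k ℤ.+ (b ℤ.* coeff (G (1 ℕ.+ n)) k ℤ.+ (coeff (G n) k ℤ.- shift (coeff (G n)) k)) ∎
  where
  open ≡-Reasoning
  Q = quadratic b

-- The numerator and the denominator as quadratics in x.

+ᵖ-vanish : ∀ p q → p ≈ᵖ [] → q ≈ᵖ [] → p +ᵖ q ≈ᵖ []
+ᵖ-vanish p q p≈0 q≈0 k = trans (coeff-+ p q k) (cong₂ ℤ._+_ (p≈0 k) (q≈0 k))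

-ᵖ-vanish : ∀ p → p ≈ᵖ [] → -ᵖ p ≈ᵖ []
-ᵖ-vanish p p≈0 k = trans (coeff-neg p k) (cong ℤ.-_ (p≈0 k))

x^2-vanish : ∀ n → (x ^ 2) (3 ℕ.+ n) ≈ᵖ []
x^2-vanish n k = trans (x*-suc (x ^ 1) (2 ℕ.+ n) k) (x*-suc 1# (1 ℕ.+ n) k)

x^2y-vanish : ∀ n → (x ^ 2 * y) (3 ℕ.+ n) ≈ᵖ []
x^2y-vanish n k = begin
  -- Two swaps are made: `*-constˡ` expects the constant series on the left, and a product computes
  -- to `[]` when its left factor is `[]`.
  coeff ((x ^ 2 * y) (3 ℕ.+ n)) k       ≡⟨ *-comm (x ^ 2) y (3 ℕ.+ n) k ⟩
  coeff ((y * x ^ 2) (3 ℕ.+ n)) k       ≡⟨ *-constˡ y (x ^ 2) (λ _ _ → refl) (3 ℕ.+ n) k ⟩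
  coeff ((y^ 1) *ᵖ (x ^ 2) (3 ℕ.+ n)) k  ≡⟨ *ᵖ-comm (y^ 1) ((x ^ 2) (3 ℕ.+ n)) k ⟩
  coeff ((x ^ 2) (3 ℕ.+ n) *ᵖ (y^ 1)) k  ≡⟨ *ᵖ-congˡ ((x ^ 2) (3 ℕ.+ n)) [] (y^ 1) (x^2-vanish n) k ⟩
  0ℤ                                    ∎
  where open ≡-Reasoning

2x-vanish : ∀ n → (2# * x) (2 ℕ.+ n) ≈ᵖ []
2x-vanish n k = trans (*-constˡ 2# x (λ _ _ → refl) (2 ℕ.+ n) k) (coeff-const-* (ℤ.+ 2) [] k)

-- Both equal `quadratic b`, for b = -1 and b = -2, so one computation with general b serves both.
-- Below degree 3 this is a finite check; from degree 3 on every term vanishes.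
numerator denominator : Series
numerator   = 1# - x + x ^ 2 - x ^ 2 * y
denominator = 1# - 2# * x + x ^ 2 - x ^ 2 * y

numerator≈ : numerator ≈ quadratic -1ℤ
numerator≈ 0 = λ { 0 → refl ; (suc _) → refl }
numerator≈ 1 = λ { 0 → refl ; 1 → refl ; (suc (suc _)) → refl }
numerator≈ 2 = λ { 0 → refl ; 1 → refl ; (suc (suc _)) → refl }
numerator≈ (suc (suc (suc n))) =
  +ᵖ-vanish ((x ^ 2) (3 ℕ.+ n)) _ (x^2-vanish n) (-ᵖ-vanish ((x ^ 2 * y) (3 ℕ.+ n)) (x^2y-vanish n))

denominator≈ : denominator ≈ quadratic (ℤ.- (ℤ.+ 2))
denominator≈ 0 = λ { 0 → refl ; (suc _) → refl }
denominator≈ 1 = λ { 0 → refl ; 1 → refl ; (suc (suc _)) → refl }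
denominator≈ 2 = λ { 0 → refl ; 1 → refl ; (suc (suc _)) → refl }
denominator≈ (suc (suc (suc n))) =
  +ᵖ-vanish ((1# - 2# * x + x ^ 2) (3 ℕ.+ n)) _
    (+ᵖ-vanish ((1# - 2# * x) (3 ℕ.+ n)) _
      (-ᵖ-vanish ((2# * x) (3 ℕ.+ n)) (2x-vanish (suc n)))
      (x^2-vanish n))
    (-ᵖ-vanish ((x ^ 2 * y) (3 ℕ.+ n)) (x^2y-vanish n))

-- Finite integer sums over lists of words.

∑ : {A : Set} → List A → (A → ℤ) → ℤ
∑ xs f = foldr (λ a s → f a ℤ.+ s) 0ℤ xs

module _ {A : Set} where

  ∑-cong-local : ∀ {xs : List A} {f g} → All (λ a → f a ≡ g a) xs → ∑ xs f ≡ ∑ xs g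
  ∑-cong-local []         = refl
  ∑-cong-local (eq ∷ eqs) = cong₂ ℤ._+_ eq (∑-cong-local eqs)

  ∑-cong : ∀ (xs : List A) {f g} → (∀ a → f a ≡ g a) → ∑ xs f ≡ ∑ xs g
  ∑-cong []       f≡g = refl
  ∑-cong (a ∷ xs) f≡g = cong₂ ℤ._+_ (f≡g a) (∑-cong xs f≡g)

  ∑-zero : ∀ (xs : List A) → ∑ xs (λ _ → 0ℤ) ≡ 0ℤ
  ∑-zero []       = refl
  ∑-zero (a ∷ xs) = trans (ℤ.+-identityˡ _) (∑-zero xs)

  ∑-++ : ∀ (xs ys : List A) f → ∑ (xs ++ ys) f ≡ ∑ xs f ℤ.+ ∑ ys f
  ∑-++ []       ys f = sym (ℤ.+-identityˡ _)
  ∑-++ (a ∷ xs) ys f = trans (cong (λ c → f a ℤ.+ c) (∑-++ xs ys f)) (sym (ℤ.+-assoc (f a) _ _))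

  ∑-map : ∀ {B : Set} (h : B → A) xs f → ∑ (map h xs) f ≡ ∑ xs (f ∘ h)
  ∑-map h []       f = refl
  ∑-map h (a ∷ xs) f = cong (λ c → f (h a) ℤ.+ c) (∑-map h xs f)

  ∑-concatMap : ∀ {B : Set} (h : B → List A) xs f → ∑ (concatMap h xs) f ≡ ∑ xs (λ b → ∑ (h b) f)
  ∑-concatMap h []       f = refl
  ∑-concatMap h (b ∷ xs) f = trans
    (∑-++ (h b) (concatMap h xs) f)
    (cong (λ c → ∑ (h b) f ℤ.+ c) (∑-concatMap h xs f))

  shift-∑ : ∀ (xs : List A) (f : A → ℕ → ℤ) k →
    shift (λ j → ∑ xs (λ a → f a j)) k ≡ ∑ xs (λ a → shift (f a) k)
  shift-∑ xs f zero    = sym (∑-zero xs)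
  shift-∑ xs f (suc k) = refl

  -- Words that the filter rejects stay in the sum with weight 0, so that later sums run over full
  -- lists of continuations.
  coeff-sum-filter : ∀ {P : Pred A 0ℓ} (P? : Decidable P) (f : A → Poly) xs k →
    coeff (sumᵖ (map f (filter P? xs))) k ≡ ∑ xs (λ a → if does (P? a) then coeff (f a) k else 0ℤ)
  coeff-sum-filter P? f []       k = refl
  coeff-sum-filter P? f (a ∷ xs) k with does (P? a)
  ... | true  = trans
    (coeff-+ (f a) (sumᵖ (map f (filter P? xs))) k)
    (cong (λ c → coeff (f a) k ℤ.+ c) (coeff-sum-filter P? f xs k))
  ... | false = trans (coeff-sum-filter P? f xs k) (sym (ℤ.+-identityˡ _))

∑-upTo-suc : ∀ n f → ∑ (upTo (suc n)) f ≡ ∑ (upTo n) f ℤ.+ f n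
∑-upTo-suc n f = begin
  ∑ (upTo (suc n)) f              ≡⟨ cong (λ xs → ∑ xs f) (upTo-∷ʳ n) ⟨
  ∑ (upTo n ++ [ n ]) f           ≡⟨ ∑-++ (upTo n) [ n ] f ⟩
  ∑ (upTo n) f ℤ.+ (f n ℤ.+ 0ℤ)   ≡⟨ cong (λ c → ∑ (upTo n) f ℤ.+ c) (ℤ.+-identityʳ (f n)) ⟩
  ∑ (upTo n) f ℤ.+ f n            ∎
  where open ≡-Reasoning

∑-continuations-suc : ∀ a n f →
  ∑ (continuations a (suc n)) f ≡ ∑ (upTo (2 ℕ.+ a)) (λ b → ∑ (continuations b n) (λ v → f (b ∷ v)))
∑-continuations-suc a n f = trans
  (∑-concatMap (λ b → map (b ∷_) (continuations b n)) (upTo (2 ℕ.+ a)) f)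
  (∑-cong (upTo (2 ℕ.+ a)) (λ b → ∑-map (b ∷_) (continuations b n) f))

-- Weights of words and changes at the front.

Hit : Word → Set
Hit = Contains _≥_ _<_

weight : Word → ℕ → ℤ
weight w k = if does (avoids? _≥?_ _<?_ w) then coeff (y^ des w) k else 0ℤ

does-avoids-cong : ∀ {v w} → Hit v ⇔ Hit w → does (avoids? _≥?_ _<?_ v) ≡ does (avoids? _≥?_ _<?_ w)
does-avoids-cong {v} {w} v⇔w =
  does-⇔ (mk⇔ (_∘ from) (_∘ to)) (avoids? _≥?_ _<?_ v) (avoids? _≥?_ _<?_ w)
  where open Equivalence v⇔w

weight-cong : ∀ v w → Hit v ⇔ Hit w → des v ≡ des w → ∀ k → weight v k ≡ weight w k
weight-cong v w v⇔w eq k = cong₂ (λ b d → if b then coeff (y^ d) k else 0ℤ)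
  (does-avoids-cong v⇔w) eq

weight-zero : ∀ {w} → Hit w → ∀ k → weight w k ≡ 0ℤ
weight-zero {w} h k rewrite dec-false (avoids? _≥?_ _<?_ w) (λ ¬h → ¬h h) = refl

des-≤ : ∀ {a b} v → a ≤ b → des (a ∷ b ∷ v) ≡ des (b ∷ v)
des-≤ {a} {b} v a≤b rewrite dec-false (a >? b) (ℕ.≤⇒≯ a≤b) = refl

des-> : ∀ {a b} v → b < a → des (a ∷ b ∷ v) ≡ suc (des (b ∷ v))
des-> {a} {b} v b<a rewrite dec-true (a >? b) b<a = refl

-- A strict ascent neither starts an occurrence of the pattern nor counts as a descent.
weight-ascent : ∀ {a b} v → a < b → ∀ k → weight (a ∷ b ∷ v) k ≡ weight (b ∷ v) k
weight-ascent {a} {b} v a<b = weight-cong (a ∷ b ∷ v) (b ∷ v)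
  (mk⇔ (λ { (here a≥b _) → contradiction a≥b (ℕ.<⇒≱ a<b) ; (there h) → h }) there)
  (des-≤ v (ℕ.<⇒≤ a<b))

hit-descent : ∀ {a b} v → b < a → Hit (a ∷ b ∷ v) ⇔ Hit (b ∷ b ∷ v)
hit-descent {a} {b} v b<a = mk⇔
  (λ { (here _ p) → here ℕ.≤-refl p ; (there h) → there h })
  (λ { (here _ p) → here (ℕ.<⇒≤ b<a) p ; (there h) → there h })

-- Replacing a by b turns a strict descent into a repeated letter. Both are weak descents and
-- restrict the rest equally, but one descent is lost, which costs a factor y.
weight-descent : ∀ {a b} v → b < a → ∀ k → weight (a ∷ b ∷ v) k ≡ shift (weight (b ∷ b ∷ v)) k
weight-descent {a} {b} v b<a k
  rewrite des-> v b<a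
        | des-≤ v (ℕ.≤-refl {b})
        | does-avoids-cong (hit-descent v b<a)
  with does (avoids? _≥?_ _<?_ (b ∷ b ∷ v)) | k
... | true  | zero  = refl
... | true  | suc _ = refl
... | false | zero  = refl
... | false | suc _ = refl

-- An occurrence starting at the extra a would need a < b, and repeating a letter adds no descent.
weight-flat-descent : ∀ {a b} v → b ≤ a → ∀ k → weight (a ∷ a ∷ b ∷ v) k ≡ weight (a ∷ b ∷ v) k
weight-flat-descent {a} {b} v b≤a = weight-cong (a ∷ a ∷ b ∷ v) (a ∷ b ∷ v)
  (mk⇔ (λ { (here _ a<b) → contradiction b≤a (ℕ.<⇒≱ a<b) ; (there h) → h }) there)
  (des-≤ {a} (b ∷ v) ℕ.≤-refl)

-- Recurrences for `A` and `B`, and the difference equation.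

A B : ℕ → ℕ → ℕ → ℤ
A n a k = ∑ (continuations a n) (λ v → weight (a ∷ v) k)
B n a k = ∑ (continuations a n) (λ v → weight (a ∷ a ∷ v) k)

weaklyBelow : ℕ → ℕ → ℕ → ℤ
weaklyBelow n a k = ∑ (upTo (suc a)) (λ b → ∑ (continuations b n) (λ v → weight (a ∷ b ∷ v) k))

A-suc′ : ∀ n a k → A (suc n) a k ≡ weaklyBelow n a k ℤ.+ A n (suc a) k
A-suc′ n a k = begin
  A (suc n) a k
    ≡⟨ ∑-continuations-suc a n (λ v → weight (a ∷ v) k) ⟩
  ∑ (upTo (2 ℕ.+ a)) (λ b → ∑ (continuations b n) (λ v → weight (a ∷ b ∷ v) k))
    -- The last letter of the list, `suc a`, is the only strict ascent that a Catalan word permits.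
    ≡⟨ ∑-upTo-suc (suc a) (λ b → ∑ (continuations b n) (λ v → weight (a ∷ b ∷ v) k)) ⟩
  weaklyBelow n a k ℤ.+ ∑ (continuations (suc a) n) (λ v → weight (a ∷ suc a ∷ v) k)
    ≡⟨ cong (λ c → weaklyBelow n a k ℤ.+ c)
         (∑-cong (continuations (suc a) n) (λ v → weight-ascent v ℕ.≤-refl k)) ⟩
  weaklyBelow n a k ℤ.+ A n (suc a) k ∎
  where open ≡-Reasoning

-- After the weak descent from a to a, the letter `suc a` completes the pattern and contributes 0,
-- while before a letter b ≤ a the doubled a can be merged into one.
B-suc′ : ∀ n a k → B (suc n) a k ≡ weaklyBelow n a k
B-suc′ n a k = begin
  B (suc n) a k
    ≡⟨ ∑-continuations-suc a n (λ v → weight (a ∷ a ∷ v) k) ⟩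
  ∑ (upTo (2 ℕ.+ a)) (λ b → ∑ (continuations b n) (λ v → weight (a ∷ a ∷ b ∷ v) k))
    ≡⟨ ∑-upTo-suc (suc a) (λ b → ∑ (continuations b n) (λ v → weight (a ∷ a ∷ b ∷ v) k)) ⟩
  ∑ (upTo (suc a)) (λ b → ∑ (continuations b n) (λ v → weight (a ∷ a ∷ b ∷ v) k))
    ℤ.+ ∑ (continuations (suc a) n) (λ v → weight (a ∷ a ∷ suc a ∷ v) k)
    ≡⟨ cong₂ ℤ._+_ (∑-cong-local (All.map below (all-upTo (suc a)))) above ⟩
  weaklyBelow n a k ℤ.+ 0ℤ
    ≡⟨ ℤ.+-identityʳ _ ⟩
  weaklyBelow n a k ∎
  where
  open ≡-Reasoning
  below : ∀ {b} → b < suc a →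
    ∑ (continuations b n) (λ v → weight (a ∷ a ∷ b ∷ v) k) ≡
    ∑ (continuations b n) (λ v → weight (a ∷ b ∷ v) k)
  below {b} (ℕ.s≤s b≤a) = ∑-cong (continuations b n) (λ v → weight-flat-descent v b≤a k)
  above : ∑ (continuations (suc a) n) (λ v → weight (a ∷ a ∷ suc a ∷ v) k) ≡ 0ℤ
  above = trans
    (∑-cong (continuations (suc a) n)
      (λ v → weight-zero {a ∷ a ∷ suc a ∷ v} (here ℕ.≤-refl ℕ.≤-refl) k))
    (∑-zero (continuations (suc a) n))

A-suc : ∀ n a k → A (suc n) a k ≡ B (suc n) a k ℤ.+ A n (suc a) k
A-suc n a k = trans (A-suc′ n a k) (cong (ℤ._+ A n (suc a) k) (sym (B-suc′ n a k)))

B-suc : ∀ n a k → B (suc n) a k ≡ ∑ (upTo a) (λ b → shift (B n b) k) ℤ.+ B n a k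
B-suc n a k = begin
  B (suc n) a k
    ≡⟨ B-suc′ n a k ⟩
  weaklyBelow n a k
    -- The summand for b = a is `B n a` by definition; only the strict descents b < a pick up a
    -- factor y.
    ≡⟨ ∑-upTo-suc a (λ b → ∑ (continuations b n) (λ v → weight (a ∷ b ∷ v) k)) ⟩
  ∑ (upTo a) (λ b → ∑ (continuations b n) (λ v → weight (a ∷ b ∷ v) k)) ℤ.+ B n a k
    ≡⟨ cong (ℤ._+ B n a k) (∑-cong-local (All.map below (all-upTo a))) ⟩
  ∑ (upTo a) (λ b → shift (B n b) k) ℤ.+ B n a k ∎
  where
  open ≡-Reasoning
  below : ∀ {b} → b < a → ∑ (continuations b n) (λ v → weight (a ∷ b ∷ v) k) ≡ shift (B n b) k
  below {b} b<a = trans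
    (∑-cong (continuations b n) (λ v → weight-descent v b<a k))
    (sym (shift-∑ (continuations b n) (λ v → weight (b ∷ b ∷ v)) k))

-- The difference equation in a, stated without subtraction.
Exchange : (ℕ → ℕ → ℕ → ℤ) → ℕ → ℕ → Set
Exchange X n a = ∀ k →
  X (suc n) (suc a) k ℤ.+ X n a k ≡ (X n (suc a) k ℤ.+ X (suc n) a k) ℤ.+ shift (X n a) k

-- Between `B-suc` at `suc a` and at a the sums over b < a cancel, leaving the single new term b =
-- a.
B-exchange : ∀ n a → Exchange B n a
B-exchange n a k = begin
  B (suc n) (suc a) k ℤ.+ B n a k
    ≡⟨ cong (ℤ._+ B n a k) (trans (B-suc n (suc a) k)
         (cong (ℤ._+ B n (suc a) k) (∑-upTo-suc a (λ b → shift (B n b) k)))) ⟩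
  ((S ℤ.+ shift (B n a) k) ℤ.+ B n (suc a) k) ℤ.+ B n a k
    ≡⟨ arrange S (shift (B n a) k) (B n (suc a) k) (B n a k) ⟩
  (B n (suc a) k ℤ.+ (S ℤ.+ B n a k)) ℤ.+ shift (B n a) k
    ≡⟨ cong (λ b → (B n (suc a) k ℤ.+ b) ℤ.+ shift (B n a) k) (B-suc n a k) ⟨
  (B n (suc a) k ℤ.+ B (suc n) a k) ℤ.+ shift (B n a) k ∎
  where
  open ≡-Reasoning
  S = ∑ (upTo a) (λ b → shift (B n b) k)
  arrange : ∀ s t u v → ((s ℤ.+ t) ℤ.+ u) ℤ.+ v ≡ (u ℤ.+ (s ℤ.+ v)) ℤ.+ t
  arrange = solve-∀

-- Induction on n with a varying. The equation is linear and `A-suc` splits each `A` into a `B` and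
-- a shorter `A` at the next letter, so `B-exchange` at (n + 1, a) and the induction hypothesis at
-- (n, a + 1) add up to the case (n + 1, a).
A-exchange : ∀ n a → Exchange A n a
A-exchange zero a k = begin
  A 1 (suc a) k ℤ.+ A 0 a k
    ≡⟨ cong (ℤ._+ A 0 a k) (A-suc 0 (suc a) k) ⟩
  (B 1 (suc a) k ℤ.+ A 0 (2 ℕ.+ a) k) ℤ.+ A 0 a k
    -- `A 0 a` computes to a value free of a, so `A 0 (2 ℕ.+ a)`, `A 0 (suc a)` and `A 0 a` are
    -- interchanged silently in this chain.
    ≡⟨ cong (λ c → (B 1 (suc a) k ℤ.+ c) ℤ.+ A 0 a k) (B≡A a k) ⟨
  (B 1 (suc a) k ℤ.+ B 0 a k) ℤ.+ A 0 a k
    ≡⟨ cong (ℤ._+ A 0 a k) (B-exchange 0 a k) ⟩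
  ((B 0 (suc a) k ℤ.+ B 1 a k) ℤ.+ shift (B 0 a) k) ℤ.+ A 0 a k
    ≡⟨ cong₂ (λ c d → ((c ℤ.+ B 1 a k) ℤ.+ d) ℤ.+ A 0 a k) (B≡A (suc a) k) (shift-cong (B≡A a) k) ⟩
  ((A 0 (suc a) k ℤ.+ B 1 a k) ℤ.+ shift (A 0 a) k) ℤ.+ A 0 (suc a) k
    ≡⟨ arrange (A 0 (suc a) k) (B 1 a k) _ _ ⟩
  (A 0 (suc a) k ℤ.+ (B 1 a k ℤ.+ A 0 (suc a) k)) ℤ.+ shift (A 0 a) k
    ≡⟨ cong (λ c → (A 0 (suc a) k ℤ.+ c) ℤ.+ shift (A 0 a) k) (A-suc 0 a k) ⟨
  (A 0 (suc a) k ℤ.+ A 1 a k) ℤ.+ shift (A 0 a) k ∎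
  where
  open ≡-Reasoning
  B≡A : ∀ a k → B 0 a k ≡ A 0 a k
  B≡A a k = cong (λ d → coeff (y^ d) k ℤ.+ 0ℤ) (des-≤ [] (ℕ.≤-refl {a}))
  arrange : ∀ p q r s → ((p ℤ.+ q) ℤ.+ r) ℤ.+ s ≡ (p ℤ.+ (q ℤ.+ s)) ℤ.+ r
  arrange = solve-∀
A-exchange (suc n) a k = begin
  A (2 ℕ.+ n) (suc a) k ℤ.+ A (suc n) a k
    ≡⟨ cong₂ ℤ._+_ (A-suc (suc n) (suc a) k) (A-suc n a k) ⟩
  (B (2 ℕ.+ n) (suc a) k ℤ.+ A (suc n) (2 ℕ.+ a) k) ℤ.+ (B (suc n) a k ℤ.+ A n (suc a) k)
    ≡⟨ interchange (B (2 ℕ.+ n) (suc a) k) _ _ _ ⟩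
  (B (2 ℕ.+ n) (suc a) k ℤ.+ B (suc n) a k) ℤ.+ (A (suc n) (2 ℕ.+ a) k ℤ.+ A n (suc a) k)
    ≡⟨ cong₂ ℤ._+_ (B-exchange (suc n) a k) (A-exchange n (suc a) k) ⟩
  ((B (suc n) (suc a) k ℤ.+ B (2 ℕ.+ n) a k) ℤ.+ shift (B (suc n) a) k)
    ℤ.+ ((A n (2 ℕ.+ a) k ℤ.+ A (suc n) (suc a) k) ℤ.+ shift (A n (suc a)) k)
    ≡⟨ arrange (B (suc n) (suc a) k) _ _ _ _ _ ⟩
  ((B (suc n) (suc a) k ℤ.+ A n (2 ℕ.+ a) k) ℤ.+ (B (2 ℕ.+ n) a k ℤ.+ A (suc n) (suc a) k))
    ℤ.+ (shift (B (suc n) a) k ℤ.+ shift (A n (suc a)) k)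
    ≡⟨ cong₂ ℤ._+_ (cong₂ ℤ._+_ (A-suc n (suc a) k) (A-suc (suc n) a k))
         (trans (shift-cong (A-suc n a) k) (shift-+ (B (suc n) a) (A n (suc a)) k)) ⟨
  (A (suc n) (suc a) k ℤ.+ A (2 ℕ.+ n) a k) ℤ.+ shift (A (suc n) a) k ∎
  where
  open ≡-Reasoning
  interchange : ∀ p q r s → (p ℤ.+ q) ℤ.+ (r ℤ.+ s) ≡ (p ℤ.+ r) ℤ.+ (q ℤ.+ s)
  interchange = solve-∀
  arrange : ∀ p q r s t u →
    ((p ℤ.+ q) ℤ.+ r) ℤ.+ ((s ℤ.+ t) ℤ.+ u) ≡ ((p ℤ.+ s) ℤ.+ (q ℤ.+ t)) ℤ.+ (r ℤ.+ u)
  arrange = solve-∀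

-- The linear recurrence for `U` and the quotient.

U : Series
U n = C _≥?_ _<?_ (suc n)

coeff-U : ∀ n k → coeff (U n) k ≡ A n 0 k
coeff-U n k = trans
  (coeff-sum-filter (avoids? _≥?_ _<?_) (λ w → y^ des w) (catalanWords (suc n)) k)
  (∑-map (0 ∷_) (continuations 0 n) (λ w → weight w k))

A-recurrence : ∀ n k →
  A (2 ℕ.+ n) 0 k ℤ.+ A n 0 k ≡ (A (1 ℕ.+ n) 0 k ℤ.+ A (1 ℕ.+ n) 0 k) ℤ.+ shift (A n 0) k
A-recurrence n k = begin
  A (2 ℕ.+ n) 0 k ℤ.+ A n 0 k
    -- No letter lies below 0, so the sum in `B-suc` is empty and `B (2 ℕ.+ n) 0` reduces to
    -- `B (suc n) 0`.
    ≡⟨ cong (ℤ._+ A n 0 k) (trans (A-suc (suc n) 0 k) (cong (ℤ._+ A (suc n) 1 k)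
         (trans (B-suc (suc n) 0 k) (ℤ.+-identityˡ (B (suc n) 0 k))))) ⟩
  (B (suc n) 0 k ℤ.+ A (suc n) 1 k) ℤ.+ A n 0 k
    ≡⟨ ℤ.+-assoc (B (suc n) 0 k) _ _ ⟩
  B (suc n) 0 k ℤ.+ (A (suc n) 1 k ℤ.+ A n 0 k)
    ≡⟨ cong (λ c → B (suc n) 0 k ℤ.+ c) (A-exchange n 0 k) ⟩
  B (suc n) 0 k ℤ.+ ((A n 1 k ℤ.+ A (suc n) 0 k) ℤ.+ shift (A n 0) k)
    ≡⟨ arrange (B (suc n) 0 k) _ _ _ ⟩
  ((B (suc n) 0 k ℤ.+ A n 1 k) ℤ.+ A (suc n) 0 k) ℤ.+ shift (A n 0) k
    ≡⟨ cong (λ c → (c ℤ.+ A (suc n) 0 k) ℤ.+ shift (A n 0) k) (A-suc n 0 k) ⟨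
  (A (suc n) 0 k ℤ.+ A (suc n) 0 k) ℤ.+ shift (A n 0) k ∎
  where
  open ≡-Reasoning
  arrange : ∀ p q r s → p ℤ.+ ((q ℤ.+ r) ℤ.+ s) ≡ ((p ℤ.+ q) ℤ.+ r) ℤ.+ s
  arrange = solve-∀

U-recurrence : ∀ n k → coeff (U (2 ℕ.+ n)) k ℤ.+ coeff (U n) k ≡
  (coeff (U (1 ℕ.+ n)) k ℤ.+ coeff (U (1 ℕ.+ n)) k) ℤ.+ shift (coeff (U n)) k
U-recurrence n k
  rewrite coeff-U (2 ℕ.+ n) k | coeff-U (1 ℕ.+ n) k | coeff-U n k | shift-cong (coeff-U n) k
  = A-recurrence n k

-- The recurrence removes every term except a multiple of `U (1 ℕ.+ n)`, whose factor 2 + b is zero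
-- for the denominator and one for the numerator.
quadratic-*-U : ∀ b n k → coeff ((quadratic b * U) (2 ℕ.+ n)) k ≡
  (ℤ.+ 2 ℤ.+ b) ℤ.* coeff (U (1 ℕ.+ n)) k
quadratic-*-U b n k = begin
  coeff ((quadratic b * U) (2 ℕ.+ n)) k
    ≡⟨ quadratic-*₂ b U n k ⟩
  u₂ ℤ.+ (b ℤ.* u₁ ℤ.+ (u₀ ℤ.- s))
    ≡⟨ collect b u₀ u₁ u₂ s ⟩
  (u₂ ℤ.+ u₀) ℤ.+ (b ℤ.* u₁ ℤ.- s)
    ≡⟨ cong (ℤ._+ (b ℤ.* u₁ ℤ.- s)) (U-recurrence n k) ⟩
  ((u₁ ℤ.+ u₁) ℤ.+ s) ℤ.+ (b ℤ.* u₁ ℤ.- s)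
    ≡⟨ cancel b u₁ s ⟩
  (ℤ.+ 2 ℤ.+ b) ℤ.* u₁ ∎
  where
  open ≡-Reasoning
  u₀ = coeff (U n) k
  u₁ = coeff (U (1 ℕ.+ n)) k
  u₂ = coeff (U (2 ℕ.+ n)) k
  s  = shift (coeff (U n)) k
  collect : ∀ b u₀ u₁ u₂ s → u₂ ℤ.+ (b ℤ.* u₁ ℤ.+ (u₀ ℤ.- s)) ≡ (u₂ ℤ.+ u₀) ℤ.+ (b ℤ.* u₁ ℤ.- s)
  collect = solve-∀
  cancel : ∀ b u s → ((u ℤ.+ u) ℤ.+ s) ℤ.+ (b ℤ.* u ℤ.- s) ≡ (ℤ.+ 2 ℤ.+ b) ℤ.* u
  cancel = solve-∀

denominator*U≈1 : denominator * U ≈ 1#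
denominator*U≈1 n k =
  trans (*-congˡ denominator (quadratic (ℤ.- (ℤ.+ 2))) U denominator≈ n k) (go n k)
  where
  go : quadratic (ℤ.- (ℤ.+ 2)) * U ≈ 1#
  go 0 k = quadratic-*₀ (ℤ.- (ℤ.+ 2)) U k
  -- `U 0` and `U 1` are the constants 1 and 2, from the word 0 and from the words 00 and 01, and 2
  -- - 2 = 0. The split on k lets the coefficients compute.
  go 1 zero    = quadratic-*₁ (ℤ.- (ℤ.+ 2)) U zero
  go 1 (suc k) = quadratic-*₁ (ℤ.- (ℤ.+ 2)) U (suc k)
  go (suc (suc n)) k = trans (quadratic-*-U (ℤ.- (ℤ.+ 2)) n k) (ℤ.*-zeroˡ (coeff (U (suc n)) k))

C≈numerator*U : C _≥?_ _<?_ ≈ numerator * U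
C≈numerator*U n k =
  trans (go n k) (sym (*-congˡ numerator (quadratic -1ℤ) U numerator≈ n k))
  where
  go : C _≥?_ _<?_ ≈ quadratic -1ℤ * U
  -- The constant terms agree because the empty word and the word 0 each contribute 1.
  go 0 k = sym (quadratic-*₀ -1ℤ U k)
  go 1 zero    = sym (quadratic-*₁ -1ℤ U zero)
  go 1 (suc k) = sym (quadratic-*₁ -1ℤ U (suc k))
  -- The left side is the coefficient of `U (suc n)` by definition, and 2 + b = 1 here.
  go (suc (suc n)) k = sym (trans (quadratic-*-U -1ℤ n k) (ℤ.*-identityˡ _))

theorem3p22 : C _≥?_ _<?_ ≈ (1# - x + x ^ 2 - x ^ 2 * y) / (1# - 2# * x + x ^ 2 - x ^ 2 * y)
theorem3p22 =
  (U , (λ n k → trans (*-comm U denominator n k) (denominator*U≈1 n k)) , denominator*U≈1) , C≈numerator*U
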